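{- Let $T$ be a finite tree with $V$ vertices. Then for all integers $k,n$ there is a natural isomorphism of $\mathbb{F}_2$-vector spaces $$SH^{k}(T,n)\cong SH^{V-2n+k}(T,V-n).$$
   Context: Let $T$ be a finite tree. A configuration $C$ on $T$ is a way of marking some vertices of $T$ by pluses and minuses and making some edges of $T$ red such that every vertex of $T$ is either marked by exactly one of the signs $+,-$ (and is then not an end of any red edge), or is unmarked and is the end of exactly one red edge. Let $Q(C)$ be the number of minuses of $C$, and let $E(C)$ be the sum of the number of minuses and the number of red edges. $SC(T)$ is the $\mathbb{F}_2$-vector space with basis the set of all configurations on $T$; $SC^{k}(T,n)$ is the subspace spanned by configurations with $Q(C)=k$, $E(C)=n$ (zero if there are none). Define a linear map $D:SC(T)\to SC(T)$ on basis elements: $D(C)$ is the sum, over all red edges $e$ of $C$, of the two configurations obtained from $C$ by making $e$ non-red and marking one of its ends by $+$ and the other by $-$ (in the two possible ways). Then $D^2=0$ and $D$ maps $SC^k(T,n)$ to $SC^{k+1}(T,n)$. The Seifert cohomology $SH^{k}(T,n)$ is the degree-$k$ cohomology of the complex $(SC^{\bullet}(T,n),D)$. -}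

module Defs where

open import Algebra.Bundles using (AbelianGroup; CommutativeRing)
open import Algebra.Module.Bundles using (Module)
open import Algebra.Module.Morphism.Structures using (IsModuleHomomorphism)
open import Algebra.Module.Structures using (IsLeftModule)
open import Algebra.Module.Structures.Biased using (IsModuleFromLeft)
import Algebra.Properties.AbelianGroup as AbelianGroupProperties
import Algebra.Properties.CommutativeMonoid.Sum as Sum
import Algebra.Properties.CommutativeSemigroup as CommutativeSemigroupProperties
open import Data.Bool.Base using (Bool; true; false; _∧_; _xor_; if_then_else_)
import Data.Bool.Properties as Bool
open import Data.Fin.Base using (Fin)
import Data.Fin.Properties as Fin
open import Data.Fin.Permutation using (Permutation; _⟨$⟩ʳ_; _⟨$⟩ˡ_; inverseˡ; inverseʳ; flip)
open import Data.Integer.Base using (ℤ; +_; 1ℤ; _-_)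
open import Data.List.Base using (List; []; _∷_; _++_; concatMap; foldr; length; map)
open import Data.List.Relation.Unary.All using (All; []; _∷_)
import Data.List.Relation.Unary.All as All
import Data.List.Relation.Unary.All.Properties as All
open import Data.List.Relation.Unary.AllPairs using ([]; _∷_)
open import Data.List.Relation.Unary.Unique.Propositional using (Unique)
open import Data.List.Properties using (map-++)
open import Data.Maybe.Base using (Maybe; just; nothing)
import Data.Maybe.Properties as Maybe
open import Data.Nat.Base using (ℕ; zero; suc; NonZero; _+_; _≤_; s≤s)
import Data.Nat.Properties as ℕ
open import Data.Product.Base using (∃; ∃-syntax; _×_; _,_; proj₁; proj₂)
open import Data.Product using (∃!)
import Data.Sign.Base as Sign
open Sign using (Sign; opposite)
import Data.Sign.Properties as Sign
open import Data.Sum.Base using (_⊎_; inj₁; inj₂)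
open import Data.Vec.Functional using (Vector; updateAt)
import Data.Vec.Functional.Properties as Vector
open import Function.Base using (_∘_; const; case_of_)
open import Function.Bundles using (mk⇔)
open import Level using (Level; 0ℓ; _⊔_)
open import Relation.Binary.Bundles using (DecSetoid; Setoid)
open import Relation.Binary.Construct.Closure.ReflexiveTransitive using (Star)
open import Relation.Binary.PropositionalEquality
  using (_≡_; _≢_; _≗_; refl; sym; trans; cong; cong₂; subst; module ≡-Reasoning)
import Relation.Binary.Reasoning.Setoid as ≈-Reasoning
open import Relation.Nullary using (¬_; Dec; yes; no; does; contradiction)
open import Relation.Nullary.Decidable using (_×-dec_; _⊎-dec_; map′; does-⇔; dec-true)
open import Relation.Unary using (Pred)

𝔽₂ : CommutativeRing 0ℓ 0ℓ
𝔽₂ = Bool.xor-∧-commutativeRing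

-- Formal sums of elements of S, two of them being equal when every
-- element of S occurs in both with the same parity: the 𝔽₂-vector
-- space with basis S.

module FormalSum (S : DecSetoid 0ℓ 0ℓ) where

  private module S = DecSetoid S
  open S using (_≟_) renaming (Carrier to A)

  -- The value at a formal sum of the linear extension of h.
  extend : (A → Bool) → List A → Bool
  extend h = foldr (λ a r → h a xor r) false

  δ : A → A → Bool
  δ a b = does (b ≟ a)

  coeff : List A → A → Bool
  coeff x a = extend (δ a) x

  infix 4 _≈_
  record _≈_ (x y : List A) : Set where
    constructor mk≈
    field coeff-≡ : ∀ a → coeff x a ≡ coeff y a
  open _≈_ public

  infixr 7 _·_
  _·_ : Bool → List A → List A
  b · x = if b then x else []

  -- The span of the basis elements satisfying P; over 𝔽₂ the linear
  -- combinations of these are just their formal sums.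
  InSpan : Pred A 0ℓ → Pred (List A) 0ℓ
  InSpan P x = ∃[ y ] All P y × y ≈ x

  extend-++ : ∀ h x y → extend h (x ++ y) ≡ extend h x xor extend h y
  extend-++ h []      y = refl
  extend-++ h (a ∷ x) y = trans (cong (h a xor_) (extend-++ h x y))
                                (sym (Bool.xor-assoc (h a) _ _))

  extend-· : ∀ h b x → extend h (b · x) ≡ b ∧ extend h x
  extend-· h true  x = refl
  extend-· h false x = refl

  Respects : (A → Bool) → Set
  Respects h = ∀ {a b} → a S.≈ b → h a ≡ h b

  ≟-respects : ∀ a → Respects (δ a)
  ≟-respects a {b} {c} b≈c = does-⇔
    (mk⇔ (S.trans (S.sym b≈c)) (S.trans b≈c)) (b ≟ a) (c ≟ a)

  private
    split : ∀ x a → coeff x a ≡ true → ∃[ y ] length x ≡ suc (length y) ×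
            (∀ h → Respects h → extend h x ≡ h a xor extend h y)
    split (b ∷ x) a p with b ≟ a
    ... | yes b≈a = x , refl , λ h r → cong (_xor extend h x) (r b≈a)
    ... | no _ with split x a p
    ...   | y , l , q = b ∷ y , cong suc l , λ h r →
            trans (cong (h b xor_) (q h r)) (swap (h b) (h a) _)
      where
      swap : ∀ p q r → p xor (q xor r) ≡ q xor (p xor r)
      swap p q r = trans (sym (Bool.xor-assoc p q r))
        (trans (cong (_xor r) (Bool.xor-comm p q)) (Bool.xor-assoc q p r))

    cancel : ∀ p q → p xor (p xor q) ≡ q
    cancel p q = trans (sym (Bool.xor-assoc p p q)) (cong (_xor q) (Bool.xor-same p))

    xor-≡ : ∀ p q → p xor q ≡ false → p ≡ q
    xor-≡ false false _ = refl
    xor-≡ true  true  _ = refl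

    extend-0 : ∀ {h} → Respects h → ∀ n x → length x ≤ n →
               (∀ a → coeff x a ≡ false) → extend h x ≡ false
    extend-0 r n [] _ _ = refl
    extend-0 {h} r (suc n) (a ∷ x) (s≤s le) z = begin
      h a xor extend h x           ≡⟨ cong (h a xor_) (q h r) ⟩
      h a xor (h a xor extend h y) ≡⟨ cancel (h a) _ ⟩
      extend h y                   ≡⟨ extend-0 r n y y≤n y-0 ⟩
      false                        ∎
      where
      open ≡-Reasoning
      a∈x : coeff x a ≡ true
      a∈x = trans (sym (xor-≡ _ _ (z a))) (dec-true (a ≟ a) S.refl)
      y   = proj₁ (split x a a∈x)
      l   = proj₁ (proj₂ (split x a a∈x))
      q   = proj₂ (proj₂ (split x a a∈x))
      y≤n : length y ≤ n
      y≤n = ℕ.≤-trans (ℕ.n≤1+n _) (subst (_≤ n) l le)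
      y-0 : ∀ b → coeff y b ≡ false
      y-0 b = trans (sym (cancel (does (a ≟ b)) _))
        (trans (cong (does (a ≟ b) xor_) (sym (q _ (≟-respects b)))) (z b))

  extend-cong : ∀ {h} → Respects h → ∀ {x y} → x ≈ y → extend h x ≡ extend h y
  extend-cong {h} r {x} {y} p = xor-≡ _ _ (trans (sym (extend-++ h x y))
    (extend-0 r _ (x ++ y) ℕ.≤-refl λ a →
      trans (extend-++ (δ a) x y)
        (trans (cong (_xor coeff y a) (coeff-≡ p a)) (Bool.xor-same (coeff y a)))))

  ≈-setoid : Setoid 0ℓ 0ℓ
  ≈-setoid = record
    { Carrier = List A
    ; _≈_ = _≈_
    ; isEquivalence = record
      { refl  = mk≈ λ _ → refl
      ; sym   = λ p → mk≈ λ a → sym (coeff-≡ p a)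
      ; trans = λ p q → mk≈ λ a → trans (coeff-≡ p a) (coeff-≡ q a)
      }
    }

  open Setoid ≈-setoid public using ()
    renaming (refl to ≈-refl; sym to ≈-sym; trans to ≈-trans; reflexive to ≈-reflexive)

  ++-cong : ∀ {x x′ y y′} → x ≈ x′ → y ≈ y′ → x ++ y ≈ x′ ++ y′
  ++-cong {x} {x′} {y} {y′} p q = mk≈ λ a → trans (extend-++ (δ a) x y)
    (trans (cong₂ _xor_ (coeff-≡ p a) (coeff-≡ q a)) (sym (extend-++ (δ a) x′ y′)))

  ∷-cong : ∀ {a b x y} → a S.≈ b → x ≈ y → a ∷ x ≈ b ∷ y
  ∷-cong a≈b p = mk≈ λ c → cong₂ _xor_ (≟-respects c a≈b) (coeff-≡ p c)

  ++-comm : ∀ x y → x ++ y ≈ y ++ x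
  ++-comm x y = mk≈ λ a → trans (extend-++ (δ a) x y)
    (trans (Bool.xor-comm (coeff x a) (coeff y a)) (sym (extend-++ (δ a) y x)))

  formalSums : Module 𝔽₂ 0ℓ 0ℓ
  formalSums = record
    { Carrierᴹ = List A
    ; _≈ᴹ_ = _≈_
    ; _+ᴹ_ = _++_
    ; _*ₗ_ = _·_
    ; _*ᵣ_ = λ x b → b · x
    ; 0ᴹ = []
    ; -ᴹ_ = λ x → x
    ; isModule = IsModuleFromLeft.isModule {commutativeRing = 𝔽₂} (record
      { isLeftModule = isLeftModule })
    }
    where
    assoc : ∀ x y z → (x ++ y) ++ z ≡ x ++ (y ++ z)
    assoc []      y z = refl
    assoc (a ∷ x) y z = cong (a ∷_) (assoc x y z)

    x+x : ∀ x → x ++ x ≈ []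
    x+x x = mk≈ λ a → trans (extend-++ (δ a) x x) (Bool.xor-same (coeff x a))

    x+0 : ∀ x → x ++ [] ≈ x
    x+0 x = ++-comm x []

    ·-cong : ∀ {b c x y} → b ≡ c → x ≈ y → b · x ≈ c · y
    ·-cong {false} refl p = ≈-refl
    ·-cong {true}  refl p = p

    ·-distribʳ : ∀ x b c → (b xor c) · x ≈ b · x ++ c · x
    ·-distribʳ x false c     = ≈-refl
    ·-distribʳ x true  false = ≈-sym (x+0 x)
    ·-distribʳ x true  true  = ≈-sym (x+x x)

    ·-distribˡ : ∀ b x y → b · (x ++ y) ≈ b · x ++ b · y
    ·-distribˡ false x y = ≈-refl
    ·-distribˡ true  x y = ≈-refl

    ·-assoc : ∀ b c x → (b ∧ c) · x ≈ b · (c · x)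
    ·-assoc false c x = ≈-refl
    ·-assoc true  c x = ≈-refl

    ·-zeroʳ : ∀ b → b · [] ≈ []
    ·-zeroʳ false = ≈-refl
    ·-zeroʳ true  = ≈-refl

    isLeftModule : IsLeftModule (CommutativeRing.ring 𝔽₂) _≈_ _++_ [] (λ x → x) _·_
    isLeftModule = record
      { isLeftSemimodule = record
        { +ᴹ-isCommutativeMonoid = record
          { isMonoid = record
            { isSemigroup = record
              { isMagma = record
                { isEquivalence = Setoid.isEquivalence ≈-setoid
                ; ∙-cong = ++-cong
                }
              ; assoc = λ x y z → ≈-reflexive (assoc x y z)
              }
            ; identity = (λ _ → ≈-refl) , x+0
            }
          ; comm = ++-comm
          }
        ; isPreleftSemimodule = record
          { *ₗ-cong = ·-cong
          ; *ₗ-zeroˡ = λ _ → ≈-refl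
          ; *ₗ-distribʳ = ·-distribʳ
          ; *ₗ-identityˡ = λ _ → ≈-refl
          ; *ₗ-assoc = ·-assoc
          ; *ₗ-zeroʳ = ·-zeroʳ
          ; *ₗ-distribˡ = ·-distribˡ
          }
        }
      ; -ᴹ‿cong = λ p → p
      ; -ᴹ‿inverse = x+x , x+x
      }

  0-span : ∀ {P} → InSpan P []
  0-span = [] , [] , ≈-refl

  +-span : ∀ {P x y} → InSpan P x → InSpan P y → InSpan P (x ++ y)
  +-span (x′ , px , p) (y′ , py , q) = x′ ++ y′ , All.++⁺ px py , ++-cong p q

  *-span : ∀ {P} b {x} → InSpan P x → InSpan P (b · x)
  *-span false _ = 0-span
  *-span true  p = p

module LinearExtension (S T : DecSetoid 0ℓ 0ℓ) where

  private
    module S = DecSetoid S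
    module T = DecSetoid T
    module 𝔽₂[S] = FormalSum S
    module 𝔽₂[T] = FormalSum T

  extend-concatMap : ∀ h (f : S.Carrier → List T.Carrier) x →
    𝔽₂[T].extend h (concatMap f x) ≡ 𝔽₂[S].extend (𝔽₂[T].extend h ∘ f) x
  extend-concatMap h f []      = refl
  extend-concatMap h f (a ∷ x) = trans (𝔽₂[T].extend-++ h (f a) _)
    (cong (𝔽₂[T].extend h (f a) xor_) (extend-concatMap h f x))

  extend-map : ∀ h (f : S.Carrier → T.Carrier) x →
    𝔽₂[T].extend h (map f x) ≡ 𝔽₂[S].extend (h ∘ f) x
  extend-map h f []      = refl
  extend-map h f (a ∷ x) = cong (h (f a) xor_) (extend-map h f x)

  map-≈ : ∀ {f} → (∀ {a b} → a S.≈ b → f a T.≈ f b) →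
          ∀ {x y} → x 𝔽₂[S].≈ y → map f x 𝔽₂[T].≈ map f y
  map-≈ {f} f-cong {x} {y} p = 𝔽₂[T].mk≈ λ a → trans (extend-map (𝔽₂[T].δ a) f x)
    (trans (𝔽₂[S].extend-cong {𝔽₂[T].δ a ∘ f} (𝔽₂[T].≟-respects a ∘ f-cong) p)
      (sym (extend-map (𝔽₂[T].δ a) f y)))

  concatMap-isHomomorphism : ∀ {f} → (∀ {a b} → a S.≈ b → f a 𝔽₂[T].≈ f b) →
    IsModuleHomomorphism (Module.rawModule 𝔽₂[S].formalSums)
                         (Module.rawModule 𝔽₂[T].formalSums) (concatMap f)
  concatMap-isHomomorphism {f} f-cong = record
    { isBimoduleHomomorphism = record
      { +ᴹ-isGroupHomomorphism = record
        { isMonoidHomomorphism = record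
          { isMagmaHomomorphism = record
            { isRelHomomorphism = record { cong = concatMap-≈ }
            ; homo = homo
            }
          ; ε-homo = 𝔽₂[T].≈-refl
          }
        ; ⁻¹-homo = λ _ → 𝔽₂[T].≈-refl
        }
      ; *ₗ-homo = *-homo
      ; *ᵣ-homo = *-homo
      }
    }
    where
    coeffs : T.Carrier → S.Carrier → Bool
    coeffs a b = 𝔽₂[T].coeff (f b) a

    concatMap-≈ : ∀ {x y} → x 𝔽₂[S].≈ y → concatMap f x 𝔽₂[T].≈ concatMap f y
    concatMap-≈ {x} {y} p = 𝔽₂[T].mk≈ λ a → trans (extend-concatMap (𝔽₂[T].δ a) f x)
      (trans (𝔽₂[S].extend-cong {coeffs a} (λ b≈c → 𝔽₂[T].coeff-≡ (f-cong b≈c) a) p)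
        (sym (extend-concatMap (𝔽₂[T].δ a) f y)))

    homo : ∀ x y → concatMap f (x ++ y) 𝔽₂[T].≈ concatMap f x ++ concatMap f y
    homo x y = 𝔽₂[T].mk≈ λ a → trans (extend-concatMap (𝔽₂[T].δ a) f (x ++ y))
      (trans (𝔽₂[S].extend-++ (coeffs a) x y)
        (trans (cong₂ _xor_ (sym (extend-concatMap (𝔽₂[T].δ a) f x)) (sym (extend-concatMap (𝔽₂[T].δ a) f y)))
          (sym (𝔽₂[T].extend-++ (𝔽₂[T].δ a) (concatMap f x) _))))

    *-homo : ∀ b x → concatMap f (b 𝔽₂[S].· x) 𝔽₂[T].≈ b 𝔽₂[T].· concatMap f x
    *-homo false x = 𝔽₂[T].≈-refl
    *-homo true  x = 𝔽₂[T].≈-refl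

record IsSubmodule {c ℓr m ℓ p : Level} {R : CommutativeRing c ℓr} (M : Module R m ℓ)
                   (P : Pred (Module.Carrierᴹ M) p) : Set (c ⊔ m ⊔ ℓ ⊔ p) where
  open Module M
  field
    resp     : ∀ {x y} → x ≈ᴹ y → P x → P y
    0-closed : P 0ᴹ
    +-closed : ∀ {x y} → P x → P y → P (x +ᴹ y)
    *-closed : ∀ r {x} → P x → P (r *ₗ x)

-- P / (P ∩ Q): the elements of P, identified when they differ by an
-- element of Q.

module Subquotient
  {c ℓr m ℓ p q : Level} {R : CommutativeRing c ℓr} (M : Module R m ℓ)
  {P : Pred (Module.Carrierᴹ M) p} {Q : Pred (Module.Carrierᴹ M) q}
  (P-sub : IsSubmodule M P) (Q-sub : IsSubmodule M Q)
  where

  private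
    module R = CommutativeRing R
    module P = IsSubmodule P-sub
    module Q = IsSubmodule Q-sub
  open Module M
  open AbelianGroupProperties +ᴹ-abelianGroup
  open CommutativeSemigroupProperties (AbelianGroup.commutativeSemigroup +ᴹ-abelianGroup)
    using (interchange)
  open ≈-Reasoning ≈ᴹ-setoid

  private
    *-neg : ∀ r x → r *ₗ (-ᴹ x) ≈ᴹ -ᴹ (r *ₗ x)
    *-neg r x = inverseˡ-unique _ _ (begin
      r *ₗ (-ᴹ x) +ᴹ r *ₗ x ≈⟨ *ₗ-distribˡ r (-ᴹ x) x ⟨
      r *ₗ (-ᴹ x +ᴹ x)      ≈⟨ *ₗ-cong R.refl (-ᴹ‿inverseˡ x) ⟩
      r *ₗ 0ᴹ               ≈⟨ *ₗ-zeroʳ r ⟩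
      0ᴹ                    ∎)

    neg≈-1* : ∀ x → (R.- R.1#) *ₗ x ≈ᴹ -ᴹ x
    neg≈-1* x = inverseˡ-unique _ _ (begin
      (R.- R.1#) *ₗ x +ᴹ x           ≈⟨ +ᴹ-congˡ (*ₗ-identityˡ x) ⟨
      (R.- R.1#) *ₗ x +ᴹ R.1# *ₗ x   ≈⟨ *ₗ-distribʳ x _ _ ⟨
      ((R.- R.1#) R.+ R.1#) *ₗ x     ≈⟨ *ₗ-cong (R.-‿inverseˡ R.1#) ≈ᴹ-refl ⟩
      R.0# *ₗ x                      ≈⟨ *ₗ-zeroˡ x ⟩
      0ᴹ                             ∎)

  neg-closed : ∀ {x} → P x → P (-ᴹ x)
  neg-closed {x} x∈P = P.resp (neg≈-1* x) (P.*-closed (R.- R.1#) x∈P)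

  Carrier : Set (m ⊔ p)
  Carrier = ∃ P

  infix 4 _≈_
  record _≈_ (x y : Carrier) : Set q where
    constructor mk≈
    field difference : Q (proj₁ x +ᴹ -ᴹ proj₁ y)
  open _≈_

  reflexive : ∀ {x y : Carrier} → proj₁ x ≈ᴹ proj₁ y → x ≈ y
  reflexive p = mk≈ (Q.resp (≈ᴹ-sym (x≈y⇒x∙y⁻¹≈ε p)) Q.0-closed)

  _+̇_ : Carrier → Carrier → Carrier
  (x , x∈P) +̇ (y , y∈P) = x +ᴹ y , P.+-closed x∈P y∈P

  _*̇_ : R.Carrier → Carrier → Carrier
  r *̇ (x , x∈P) = r *ₗ x , P.*-closed r x∈P

  -̇_ : Carrier → Carrier
  -̇ (x , x∈P) = -ᴹ x , neg-closed x∈P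

  private
    ≈-sym : ∀ {x y} → x ≈ y → y ≈ x
    ≈-sym {x , _} {y , _} p = mk≈ (Q.resp (begin
      (R.- R.1#) *ₗ (x +ᴹ -ᴹ y) ≈⟨ neg≈-1* _ ⟩
      -ᴹ (x +ᴹ -ᴹ y)            ≈⟨ ⁻¹-anti-homo‿- x y ⟩
      y +ᴹ -ᴹ x                 ∎) (Q.*-closed (R.- R.1#) (difference p)))

    ≈-trans : ∀ {x y z} → x ≈ y → y ≈ z → x ≈ z
    ≈-trans {x , _} {y , _} {z , _} p q = mk≈ (Q.resp (begin
      (x +ᴹ -ᴹ y) +ᴹ (y +ᴹ -ᴹ z) ≈⟨ +ᴹ-assoc _ _ _ ⟨
      ((x +ᴹ -ᴹ y) +ᴹ y) +ᴹ -ᴹ z ≈⟨ +ᴹ-congʳ (//-rightDividesˡ y x) ⟩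
      x +ᴹ -ᴹ z                  ∎) (Q.+-closed (difference p) (difference q)))

    +-cong : ∀ {x x′ y y′} → x ≈ x′ → y ≈ y′ → (x +̇ y) ≈ (x′ +̇ y′)
    +-cong {x , _} {x′ , _} {y , _} {y′ , _} p q = mk≈ (Q.resp (begin
      (x +ᴹ -ᴹ x′) +ᴹ (y +ᴹ -ᴹ y′)  ≈⟨ interchange _ _ _ _ ⟩
      (x +ᴹ y) +ᴹ (-ᴹ x′ +ᴹ -ᴹ y′)  ≈⟨ +ᴹ-congˡ (⁻¹-∙-comm x′ y′) ⟩
      (x +ᴹ y) +ᴹ -ᴹ (x′ +ᴹ y′)     ∎) (Q.+-closed (difference p) (difference q)))

    *-cong : ∀ {r s x y} → r R.≈ s → x ≈ y → (r *̇ x) ≈ (s *̇ y)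
    *-cong {r} {s} {x , _} {y , _} r≈s p = mk≈ (Q.resp (begin
      r *ₗ (x +ᴹ -ᴹ y)        ≈⟨ *ₗ-distribˡ r x _ ⟩
      r *ₗ x +ᴹ r *ₗ (-ᴹ y)   ≈⟨ +ᴹ-congˡ (*-neg r y) ⟩
      r *ₗ x +ᴹ -ᴹ (r *ₗ y)   ≈⟨ +ᴹ-congˡ (-ᴹ‿cong (*ₗ-cong r≈s ≈ᴹ-refl)) ⟩
      r *ₗ x +ᴹ -ᴹ (s *ₗ y)   ∎) (Q.*-closed r (difference p)))

    neg-cong : ∀ {x y} → x ≈ y → (-̇ x) ≈ (-̇ y)
    neg-cong {x , _} {y , _} p = mk≈ (Q.resp (begin
      (R.- R.1#) *ₗ (x +ᴹ -ᴹ y) ≈⟨ neg≈-1* _ ⟩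
      -ᴹ (x +ᴹ -ᴹ y)            ≈⟨ ⁻¹-∙-comm x (-ᴹ y) ⟨
      -ᴹ x +ᴹ -ᴹ (-ᴹ y)         ∎) (Q.*-closed (R.- R.1#) (difference p)))

    isLeftModuleᵠ : IsLeftModule R.ring _≈_ _+̇_ (0ᴹ , P.0-closed) -̇_ _*̇_
    isLeftModuleᵠ = record
      { isLeftSemimodule = record
        { +ᴹ-isCommutativeMonoid = record
          { isMonoid = record
            { isSemigroup = record
              { isMagma = record
                { isEquivalence = record
                  { refl = reflexive ≈ᴹ-refl ; sym = ≈-sym ; trans = ≈-trans }
                ; ∙-cong = +-cong
                }
              ; assoc = λ _ _ _ → reflexive (+ᴹ-assoc _ _ _)
              }
            ; identity = (λ _ → reflexive (+ᴹ-identityˡ _)) , (λ _ → reflexive (+ᴹ-identityʳ _))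
            }
          ; comm = λ _ _ → reflexive (+ᴹ-comm _ _)
          }
        ; isPreleftSemimodule = record
          { *ₗ-cong = *-cong
          ; *ₗ-zeroˡ = λ _ → reflexive (*ₗ-zeroˡ _)
          ; *ₗ-distribʳ = λ _ _ _ → reflexive (*ₗ-distribʳ _ _ _)
          ; *ₗ-identityˡ = λ _ → reflexive (*ₗ-identityˡ _)
          ; *ₗ-assoc = λ _ _ _ → reflexive (*ₗ-assoc _ _ _)
          ; *ₗ-zeroʳ = λ _ → reflexive (*ₗ-zeroʳ _)
          ; *ₗ-distribˡ = λ _ _ _ → reflexive (*ₗ-distribˡ _ _ _)
          }
        }
      ; -ᴹ‿cong = neg-cong
      ; -ᴹ‿inverse = (λ _ → reflexive (-ᴹ‿inverseˡ _)) , (λ _ → reflexive (-ᴹ‿inverseʳ _))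
      }

  subquotient : Module R (m ⊔ p) q
  subquotient = record
    { Carrierᴹ = Carrier
    ; _≈ᴹ_ = _≈_
    ; _+ᴹ_ = _+̇_
    ; _*ₗ_ = _*̇_
    ; _*ᵣ_ = λ x r → r *̇ x
    ; 0ᴹ = 0ᴹ , P.0-closed
    ; -ᴹ_ = -̇_
    ; isModule = IsModuleFromLeft.isModule {commutativeRing = R} (record
      { isLeftModule = isLeftModuleᵠ })
    }

record Graph (V : ℕ) : Set where
  field
    E    : ℕ
    ends : Fin E → Fin V × Fin V   -- the order of the two ends is immaterial

  Joins : Fin E → Fin V → Fin V → Set
  Joins e u v = ends e ≡ (u , v) ⊎ ends e ≡ (v , u)

  infix 4 _endOf_
  _endOf_ : Fin V → Fin E → Set
  v endOf e = v ≡ proj₁ (ends e) ⊎ v ≡ proj₂ (ends e)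

  Adjacent : Fin V → Fin V → Set
  Adjacent u v = ∃[ e ] Joins e u v

  -- Walk u v vs es: a walk from u to v with edges es, leaving
  -- successively the vertices vs.
  data Walk : Fin V → Fin V → List (Fin V) → List (Fin E) → Set where
    []  : ∀ {u} → Walk u u [] []
    _∷_ : ∀ {u v w e vs es} → Joins e u v → Walk v w vs es → Walk u w (u ∷ vs) (e ∷ es)

  -- Loops and pairs of parallel edges count as cycles.
  record Cycle : Set where
    field
      {base}          : Fin V
      {vertices}      : List (Fin V)
      {edges}         : List (Fin E)
      walk            : Walk base base vertices edges
      nonempty        : edges ≢ []
      unique-vertices : Unique vertices
      unique-edges    : Unique edges

record Tree (V : ℕ) : Set where
  field
    graph : Graph V
  open Graph graph public
  field
    nonempty  : NonZero V
    connected : ∀ u v → Star Adjacent u v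
    acyclic   : ¬ Cycle

  ends-distinct : ∀ e → proj₁ (ends e) ≢ proj₂ (ends e)
  ends-distinct e a≡b = acyclic record
    { walk = inj₁ (cong (proj₁ (ends e) ,_) (sym a≡b)) ∷ []
    ; nonempty = λ ()
    ; unique-vertices = [] ∷ []
    ; unique-edges = [] ∷ []
    }

module _ {V : ℕ} where

  -- Isomorphic trees have equally many vertices, so nothing is lost by
  -- fixing V; Joins makes the orientation of edges irrelevant.
  infix 4 _≅_
  record _≅_ (S T : Tree V) : Set where
    private
      module S = Tree S
      module T = Tree T
    field
      vertex   : Permutation V V
      edge     : Permutation S.E T.E
      incident : ∀ {e u v} → S.Joins e u v → T.Joins (edge ⟨$⟩ʳ e) (vertex ⟨$⟩ʳ u) (vertex ⟨$⟩ʳ v)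

module Configurations {V : ℕ} (T : Tree V) where

  open Tree T

  module _ (mark : Vector (Maybe Sign) V) (red : Vector Bool E) where

    Marked : Fin V → Set
    Marked v = (∃[ s ] mark v ≡ just s) × (∀ e → v endOf e → red e ≢ true)

    Matched : Fin V → Set
    Matched v = mark v ≡ nothing × ∃! _≡_ (λ e → v endOf e × red e ≡ true)

  record Config : Set where
    field
      mark  : Vector (Maybe Sign) V
      red   : Vector Bool E
      valid : ∀ v → Marked mark red v ⊎ Matched mark red v
  open Config public

  infix 4 _≈_
  record _≈_ (C C′ : Config) : Set where
    constructor mk≈
    field
      mark-≗ : mark C ≗ mark C′
      red-≗  : red C ≗ red C′
  open _≈_ public

  configs : DecSetoid 0ℓ 0ℓ
  configs = record
    { Carrier = Config
    ; _≈_ = _≈_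
    ; isDecEquivalence = record
      { isEquivalence = record
        { refl  = mk≈ (λ _ → refl) (λ _ → refl)
        ; sym   = λ p → mk≈ (sym ∘ mark-≗ p) (sym ∘ red-≗ p)
        ; trans = λ p q → mk≈ (λ v → trans (mark-≗ p v) (mark-≗ q v))
                              (λ e → trans (red-≗ p e) (red-≗ q e))
        }
      ; _≟_ = λ C C′ → map′ (λ (p , q) → mk≈ p q) (λ p → mark-≗ p , red-≗ p)
          (Vector.≗-dec (Maybe.≡-dec Sign._≟_) (mark C) (mark C′)
            ×-dec Vector.≗-dec Bool._≟_ (red C) (red C′))
      }
    }

  #minus : Maybe Sign → ℕ
  #minus (just Sign.-) = 1
  #minus _             = 0

  #red : Bool → ℕ
  #red b = if b then 1 else 0

  open Sum ℕ.+-0-commutativeMonoid using () renaming (sum to sumℕ)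

  Q : Config → ℕ
  Q C = sumℕ (#minus ∘ mark C)

  -- E is the number of edges of the tree, hence the name.
  E# : Config → ℕ
  E# C = Q C + sumℕ (#red ∘ red C)

  module SC = FormalSum configs

  SC : Module 𝔽₂ 0ℓ 0ℓ
  SC = SC.formalSums

  SC[_,_] : ℤ → ℤ → Pred (List Config) 0ℓ
  SC[ k , n ] = SC.InSpan (λ C → + Q C ≡ k × + E# C ≡ n)

  -- The first end of e gets the sign s, the second the opposite sign.
  module _ (C : Config) (e : Fin E) (e-red : red C e ≡ true) (s : Sign) where

    private
      a b : Fin V
      a = proj₁ (ends e)
      b = proj₂ (ends e)

    mark-resolve : Vector (Maybe Sign) V
    mark-resolve = updateAt (updateAt (mark C) b (const (just (opposite s)))) a (const (just s))

    red-resolve : Vector Bool E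
    red-resolve = updateAt (red C) e (const false)

    mark-first : mark-resolve a ≡ just s
    mark-first = Vector.updateAt-updates a _

    mark-second : a ≢ b → mark-resolve b ≡ just (opposite s)
    mark-second a≢b = trans (Vector.updateAt-minimal b a _ (a≢b ∘ sym)) (Vector.updateAt-updates b _)

    mark-other : ∀ {v} → ¬ v endOf e → mark-resolve v ≡ mark C v
    mark-other {v} v∉e = trans (Vector.updateAt-minimal v a _ (v∉e ∘ inj₁))
                               (Vector.updateAt-minimal v b _ (v∉e ∘ inj₂))

    red-self : red-resolve e ≡ false
    red-self = Vector.updateAt-updates e _

    red-other : ∀ {f} → f ≢ e → red-resolve f ≡ red C f
    red-other {f} f≢e = Vector.updateAt-minimal f e _ f≢e

    red-before : ∀ {f} → red-resolve f ≡ true → f ≢ e × red C f ≡ true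
    red-before {f} p with f Fin.≟ e
    ... | yes refl = contradiction (trans (sym p) red-self) λ ()
    ... | no f≢e   = f≢e , trans (sym (red-other f≢e)) p

    end-marked : ∀ {v} → v endOf e → ∃[ t ] mark-resolve v ≡ just t
    end-marked (inj₁ refl) = s , mark-first
    end-marked (inj₂ refl) = case a Fin.≟ b of λ
      { (yes a≡b) → s , trans (cong mark-resolve (sym a≡b)) mark-first
      ; (no a≢b)  → opposite s , mark-second a≢b
      }

    endOf? : ∀ v → Dec (v endOf e)
    endOf? v = v Fin.≟ a ⊎-dec v Fin.≟ b

    valid-resolve : ∀ v → Marked mark-resolve red-resolve v ⊎ Matched mark-resolve red-resolve v
    valid-resolve v with endOf? v | valid C v
    ... | yes v∈e | inj₁ (_ , no-red) = contradiction e-red (no-red e v∈e)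
    ... | yes v∈e | inj₂ (_ , f , _ , unique) = inj₁ (end-marked v∈e , λ f′ v∈f′ p →
          proj₁ (red-before p) (trans (sym (unique (v∈f′ , proj₂ (red-before p)))) (unique (v∈e , e-red))))
    ... | no v∉e | inj₁ ((t , p) , no-red) =
          inj₁ ((t , trans (mark-other v∉e) p) , λ f v∈f q → no-red f v∈f (proj₂ (red-before q)))
    ... | no v∉e | inj₂ (p , f , (v∈f , q) , unique) =
          inj₂ (trans (mark-other v∉e) p , f
               , (v∈f , trans (red-other λ { refl → v∉e v∈f }) q)
               , λ (v∈f′ , q′) → unique (v∈f′ , proj₂ (red-before q′)))

    resolve : Config
    resolve = record { mark = mark-resolve ; red = red-resolve ; valid = valid-resolve }

    resolve-unique : ∀ {C′} → mark C′ a ≡ just s → mark C′ b ≡ just (opposite s) →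
      (∀ {v} → ¬ v endOf e → mark C′ v ≡ mark C v) →
      red C′ e ≡ false → (∀ {f} → f ≢ e → red C′ f ≡ red C f) → C′ ≈ resolve
    resolve-unique {C′} at-a at-b off at-e off-e = mk≈ marks reds
      where
      marks : mark C′ ≗ mark-resolve
      marks v = case endOf? v of λ
        { (yes (inj₁ refl)) → trans at-a (sym mark-first)
        ; (yes (inj₂ refl)) → trans at-b (sym (mark-second (ends-distinct e)))
        ; (no v∉e)          → trans (off v∉e) (sym (mark-other v∉e))
        }

      reds : red C′ ≗ red-resolve
      reds f = case f Fin.≟ e of λ
        { (yes refl) → trans at-e (sym red-self)
        ; (no f≢e)   → trans (off-e f≢e) (sym (red-other f≢e))
        }

  resolutions : Config → Fin E → List Config
  resolutions C e with red C e Bool.≟ true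
  ... | yes e-red = resolve C e e-red Sign.+ ∷ resolve C e e-red Sign.- ∷ []
  ... | no  _     = []

  module ∑ = Sum (Module.+ᴹ-commutativeMonoid SC)

  D : List Config → List Config
  D = concatMap (λ C → ∑.sum (resolutions C))

  private
    resolve-cong : ∀ {C C′} → C ≈ C′ → ∀ {e} p p′ s → resolve C e p s ≈ resolve C′ e p′ s
    resolve-cong {C} {C′} C≈C′ {e} p p′ s = resolve-unique C′ e p′ s
      (mark-first C e p s) (mark-second C e p s (ends-distinct e))
      (λ v∉e → trans (mark-other C e p s v∉e) (mark-≗ C≈C′ _))
      (red-self C e p s) (λ f≢e → trans (red-other C e p s f≢e) (red-≗ C≈C′ _))

    resolutions-cong : ∀ {C C′} → C ≈ C′ → ∀ e → resolutions C e SC.≈ resolutions C′ e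
    resolutions-cong {C} {C′} C≈C′ e with red C e Bool.≟ true | red C′ e Bool.≟ true
    ... | yes p | yes p′ = SC.∷-cong (resolve-cong C≈C′ p p′ _)
                             (SC.∷-cong (resolve-cong C≈C′ p p′ _) SC.≈-refl)
    ... | yes p | no ¬p′ = contradiction (trans (sym (red-≗ C≈C′ e)) p) ¬p′
    ... | no ¬p | yes p′ = contradiction (trans (red-≗ C≈C′ e) p′) ¬p
    ... | no _  | no _   = SC.≈-refl

  D-isHomomorphism : IsModuleHomomorphism (Module.rawModule SC) (Module.rawModule SC) D
  D-isHomomorphism = LinearExtension.concatMap-isHomomorphism configs configs
    (λ C≈C′ → ∑.sum-cong-≋ (resolutions-cong C≈C′))

  Cocycle Coboundary : ℤ → ℤ → Pred (List Config) 0ℓ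
  Cocycle    k n x = SC[ k , n ] x × D x SC.≈ []
  Coboundary k n x = ∃[ y ] SC[ k - 1ℤ , n ] y × D y SC.≈ x

  private
    module D = IsModuleHomomorphism D-isHomomorphism

  cocycle-isSubmodule : ∀ k n → IsSubmodule SC (Cocycle k n)
  cocycle-isSubmodule k n = record
    { resp     = λ x≈y ((z , pz , z≈x) , Dx) →
        (z , pz , SC.≈-trans z≈x x≈y) , SC.≈-trans (D.⟦⟧-cong (SC.≈-sym x≈y)) Dx
    ; 0-closed = SC.0-span , SC.≈-refl
    ; +-closed = λ {x} {y} (px , Dx) (py , Dy) →
        SC.+-span px py , SC.≈-trans (D.+ᴹ-homo x y) (SC.++-cong Dx Dy)
    ; *-closed = λ r {x} (px , Dx) →
        SC.*-span r px , SC.≈-trans (D.*ₗ-homo r x)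
          (SC.≈-trans (Module.*ₗ-cong SC {r} refl Dx) (Module.*ₗ-zeroʳ SC r))
    }

  coboundary-isSubmodule : ∀ k n → IsSubmodule SC (Coboundary k n)
  coboundary-isSubmodule k n = record
    { resp     = λ x≈x′ (y , py , Dy) → y , py , SC.≈-trans Dy x≈x′
    ; 0-closed = [] , SC.0-span , SC.≈-refl
    ; +-closed = λ (y , py , Dy) (y′ , py′ , Dy′) →
        y ++ y′ , SC.+-span py py′ , SC.≈-trans (D.+ᴹ-homo y y′) (SC.++-cong Dy Dy′)
    ; *-closed = λ r (y , py , Dy) →
        r SC.· y , SC.*-span r py
        , SC.≈-trans (D.*ₗ-homo r y) (Module.*ₗ-cong SC {r} refl Dy)
    }

  SH : ℤ → ℤ → Module 𝔽₂ 0ℓ 0ℓ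
  SH k n = Subquotient.subquotient SC (cocycle-isSubmodule k n) (coboundary-isSubmodule k n)

module Induced {V : ℕ} {S T : Tree V} (g : S ≅ T) where

  private
    module S where
      open Tree S public
      open Configurations S public
    module T where
      open Tree T public
      open Configurations T public
  open _≅_ g
  open Configurations using (mark; red; valid; mk≈; SH)

  private
    gᵥ : Fin V → Fin V
    gᵥ = vertex ⟨$⟩ʳ_

    gᵥ⁻¹ : Fin V → Fin V
    gᵥ⁻¹ = vertex ⟨$⟩ˡ_

    gₑ : Fin S.E → Fin T.E
    gₑ = edge ⟨$⟩ʳ_

    gₑ⁻¹ : Fin T.E → Fin S.E
    gₑ⁻¹ = edge ⟨$⟩ˡ_

    endOf⁺ : ∀ {v e} → v S.endOf e → gᵥ v T.endOf gₑ e
    endOf⁺ {v} {e} v∈e with incident {e} (inj₁ refl) | v∈e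
    ... | inj₁ p | inj₁ refl = inj₁ (sym (cong proj₁ p))
    ... | inj₁ p | inj₂ refl = inj₂ (sym (cong proj₂ p))
    ... | inj₂ p | inj₁ refl = inj₂ (sym (cong proj₂ p))
    ... | inj₂ p | inj₂ refl = inj₁ (sym (cong proj₁ p))

    injective : ∀ {u v} → gᵥ u ≡ gᵥ v → u ≡ v
    injective p = trans (sym (inverseˡ vertex)) (trans (cong gᵥ⁻¹ p) (inverseˡ vertex))

    endOf⁻ : ∀ {v e} → gᵥ v T.endOf gₑ e → v S.endOf e
    endOf⁻ {v} {e} v∈e with incident {e} (inj₁ refl) | v∈e
    ... | inj₁ p | inj₁ q = inj₁ (injective (trans q (cong proj₁ p)))
    ... | inj₁ p | inj₂ q = inj₂ (injective (trans q (cong proj₂ p)))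
    ... | inj₂ p | inj₁ q = inj₂ (injective (trans q (cong proj₁ p)))
    ... | inj₂ p | inj₂ q = inj₁ (injective (trans q (cong proj₂ p)))

    endOf-from : ∀ {v e} → v T.endOf e → gᵥ⁻¹ v S.endOf gₑ⁻¹ e
    endOf-from {v} {e} v∈e = endOf⁻ (subst (λ (v , e) → v T.endOf e)
      (cong₂ _,_ (sym (inverseʳ vertex)) (sym (inverseʳ edge))) v∈e)

    endOf-to : ∀ {v e} → gᵥ⁻¹ v S.endOf e → v T.endOf gₑ e
    endOf-to {v} {e} v∈e = subst (T._endOf gₑ e) (inverseʳ vertex) (endOf⁺ v∈e)

  push : S.Config → T.Config
  push C = record
    { mark  = mark C ∘ gᵥ⁻¹
    ; red   = red C ∘ gₑ⁻¹
    ; valid = valid′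
    }
    where
    valid′ : ∀ v → T.Marked (mark C ∘ gᵥ⁻¹) (red C ∘ gₑ⁻¹) v ⊎
                   T.Matched (mark C ∘ gᵥ⁻¹) (red C ∘ gₑ⁻¹) v
    valid′ v with valid C (gᵥ⁻¹ v)
    ... | inj₁ (marked , no-red) = inj₁ (marked , λ e v∈e → no-red (gₑ⁻¹ e) (endOf-from v∈e))
    ... | inj₂ (unmarked , e , (v∈e , p) , unique) = inj₂ (unmarked , gₑ e
          , (endOf-to v∈e , trans (cong (red C) (inverseˡ edge)) p)
          , λ (v∈f , q) → trans (cong gₑ (unique (endOf-from v∈f , q))) (inverseʳ edge))

  push-cong : ∀ {C C′} → C S.≈ C′ → push C T.≈ push C′
  push-cong (mk≈ p q) = mk≈ (p ∘ gᵥ⁻¹) (q ∘ gₑ⁻¹)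

  private
    module ∑ℕ = Sum ℕ.+-0-commutativeMonoid

  Q-push : ∀ C → T.Q (push C) ≡ S.Q C
  Q-push C = sym (∑ℕ.sum-permute (S.#minus ∘ mark C) (flip vertex))

  E#-push : ∀ C → T.E# (push C) ≡ S.E# C
  E#-push C = cong₂ _+_ (Q-push C) (sym (∑ℕ.sum-permute (S.#red ∘ red C) (flip edge)))

  private
    module _ (C : S.Config) (e : Fin S.E) (p : red C e ≡ true)
             (p′ : red (push C) (gₑ e) ≡ true) where

      a b : Fin V
      a = proj₁ (S.ends e)
      b = proj₂ (S.ends e)

      mark-at : ∀ s {u v m} → v ≡ gᵥ u → S.mark-resolve C e p s u ≡ m →
                mark (push (S.resolve C e p s)) v ≡ m
      mark-at s v≡gu q = trans (cong (S.mark-resolve C e p s)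
        (trans (cong gᵥ⁻¹ v≡gu) (inverseˡ vertex))) q

      resolve-push : ∀ s t →
        mark (push (S.resolve C e p s)) (proj₁ (T.ends (gₑ e))) ≡ just t →
        mark (push (S.resolve C e p s)) (proj₂ (T.ends (gₑ e))) ≡ just (opposite t) →
        push (S.resolve C e p s) T.≈ T.resolve (push C) (gₑ e) p′ t
      resolve-push s t at-a at-b = T.resolve-unique (push C) (gₑ e) p′ t at-a at-b
        (λ v∉ge → S.mark-other C e p s (v∉ge ∘ endOf-to))
        (trans (cong (S.red-resolve C e p s) (inverseˡ edge)) (S.red-self C e p s))
        (λ f≢ge → S.red-other C e p s
          (λ f′≡e → f≢ge (trans (sym (inverseʳ edge)) (cong gₑ f′≡e))))

      resolve-straight : T.ends (gₑ e) ≡ (gᵥ a , gᵥ b) → ∀ s →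
        push (S.resolve C e p s) T.≈ T.resolve (push C) (gₑ e) p′ s
      resolve-straight q s = resolve-push s s
        (mark-at s (cong proj₁ q) (S.mark-first C e p s))
        (mark-at s (cong proj₂ q) (S.mark-second C e p s (S.ends-distinct e)))

      resolve-flipped : T.ends (gₑ e) ≡ (gᵥ b , gᵥ a) → ∀ s →
        push (S.resolve C e p s) T.≈ T.resolve (push C) (gₑ e) p′ (opposite s)
      resolve-flipped q s = resolve-push s (opposite s)
        (mark-at s (cong proj₁ q) (S.mark-second C e p s (S.ends-distinct e)))
        (mark-at s (cong proj₂ q) (trans (S.mark-first C e p s)
          (cong just (sym (Sign.opposite-involutive s)))))

    resolutions-push : ∀ C e →
      map push (S.resolutions C e) T.SC.≈ T.resolutions (push C) (gₑ e)
    resolutions-push C e with red C e Bool.≟ true | red (push C) (gₑ e) Bool.≟ true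
    ... | yes p | no ¬p′ = contradiction (trans (cong (red C) (inverseˡ edge)) p) ¬p′
    ... | no ¬p | yes p′ = contradiction (trans (sym (cong (red C) (inverseˡ edge))) p′) ¬p
    ... | no _  | no _   = T.SC.≈-refl
    ... | yes p | yes p′ with incident {e} (inj₁ refl)
    ...   | inj₁ q = T.SC.∷-cong (resolve-straight C e p p′ q Sign.+)
                       (T.SC.∷-cong (resolve-straight C e p p′ q Sign.-) T.SC.≈-refl)
    ...   | inj₂ q = T.SC.≈-trans
                       (T.SC.∷-cong (resolve-flipped C e p p′ q Sign.+)
                         (T.SC.∷-cong (resolve-flipped C e p p′ q Sign.-) T.SC.≈-refl))
                       (T.SC.++-comm (T.resolve (push C) (gₑ e) p′ Sign.- ∷ [])
                                     (T.resolve (push C) (gₑ e) p′ Sign.+ ∷ []))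

    map-sum : ∀ {n} (f : Vector (List S.Config) n) →
              map push (S.∑.sum f) ≡ T.∑.sum (map push ∘ f)
    map-sum {zero}  f = refl
    map-sum {suc n} f = trans (map-++ push (f Fin.zero) _)
                              (cong (map push (f Fin.zero) ++_) (map-sum (f ∘ Fin.suc)))

    D-push-basis : ∀ C → map push (S.∑.sum (S.resolutions C)) T.SC.≈
                         T.∑.sum (T.resolutions (push C))
    D-push-basis C = T.SC.≈-trans (T.SC.≈-reflexive (map-sum (S.resolutions C)))
      (T.SC.≈-trans (T.∑.sum-cong-≋ (resolutions-push C))
        (T.SC.≈-sym (T.∑.sum-permute (T.resolutions (push C)) edge)))

  D-push : ∀ x → map push (S.D x) T.SC.≈ T.D (map push x)
  D-push []      = T.SC.≈-refl
  D-push (C ∷ x) = T.SC.≈-trans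
    (T.SC.≈-reflexive (map-++ push (S.∑.sum (S.resolutions C)) _))
    (T.SC.++-cong (D-push-basis C) (D-push x))

  map-push-cong : ∀ {x y} → x S.SC.≈ y → map push x T.SC.≈ map push y
  map-push-cong = LinearExtension.map-≈ S.configs T.configs push-cong

  SC-push : ∀ {k n x} → S.SC[ k , n ] x → T.SC[ k , n ] (map push x)
  SC-push {k} {n} (y , py , y≈x) = map push y
    , All.map⁺ (All.map (λ {C} (p , q) → trans (cong +_ (Q-push C)) p
                                       , trans (cong +_ (E#-push C)) q) py)
    , map-push-cong y≈x

  SH-map : ∀ k n → Module.Carrierᴹ (SH S k n) → Module.Carrierᴹ (SH T k n)
  SH-map k n (x , x∈SC , Dx≈0) = map push x , SC-push x∈SC
    , T.SC.≈-trans (T.SC.≈-sym (D-push x)) (map-push-cong Dx≈0)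

  SH-map-cong : ∀ k n {x y} → Module._≈ᴹ_ (SH S k n) x y →
                Module._≈ᴹ_ (SH T k n) (SH-map k n x) (SH-map k n y)
  SH-map-cong k n {x , _} {y , _} (Subquotient.mk≈ (w , w∈SC , Dw≈x+y)) =
    Subquotient.mk≈ (map push w , SC-push w∈SC
      , T.SC.≈-trans (T.SC.≈-sym (D-push w))
          (T.SC.≈-trans (map-push-cong Dw≈x+y) (T.SC.≈-reflexive (map-++ push x y))))

{-# OPTIONS --safe #-}

-- Reversing all signs of a configuration is an involution commuting with D,
-- as D resolves a red edge in both possible ways.  A configuration with p
-- pluses, k minuses and r red edges has p + k + 2 r = V, every unmarked vertex
-- lying on exactly one red edge; so from n = k + r the reversed configuration
-- has p = V − 2 n + k minuses and p + r = V − n minuses and red edges.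

module Submission where

open import Defs
open import Algebra.Module.Bundles using (Module)
open import Algebra.Module.Morphism.Structures using (IsModuleIsomorphism)
import Algebra.Properties.CommutativeMonoid.Sum as BigSum
open import Data.Bool.Base using (true; false; if_then_else_)
import Data.Bool.Properties as Bool
open import Data.Fin.Base using (Fin; zero; suc)
import Data.Fin.Properties as Fin
open import Data.Integer.Base using (ℤ; +_; 1ℤ; _+_; _-_; _*_)
open import Data.Integer.Tactic.RingSolver using (solve-∀)
open import Data.List.Base using (List; []; _∷_; _++_; map)
open import Data.List.Properties using (map-++)
import Data.List.Relation.Unary.All as All
import Data.List.Relation.Unary.All.Properties as All
import Data.Maybe.Base as Maybe
open Maybe using (Maybe; just; nothing)
open import Data.Nat.Base as ℕ using (ℕ)
import Data.Nat.Properties as ℕ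
open import Data.Nat.Tactic.RingSolver using () renaming (solve-∀ to solve-∀-ℕ)
open import Data.Product.Base using (Σ-syntax; _×_; _,_; proj₁; proj₂)
import Data.Sign.Base as Sign
open Sign using (Sign; opposite)
import Data.Sign.Properties as Sign
open import Data.Sum.Base as Sum using (inj₁; inj₂)
open import Data.Vec.Functional using (Vector; replicate; removeAt)
open import Function.Base using (_∘_)
open import Relation.Binary.PropositionalEquality
  using (_≡_; _≢_; refl; sym; trans; cong; cong₂; subst; subst₂; module ≡-Reasoning)
open import Relation.Nullary using (¬_; yes; no; does)
open import Relation.Nullary.Decidable using (dec-true; dec-false)
open Configurations using (SH)
open Induced using (SH-map)
open Module using (Carrierᴹ; rawModule)

-- Finite sums of natural numbers.

module ∑ℕ = BigSum ℕ.+-0-commutativeMonoid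
open ∑ℕ using (sum; sum-syntax)

sum-zero : ∀ {n} {f : Vector ℕ n} → (∀ i → f i ≡ 0) → sum f ≡ 0
sum-zero {n} f≡0 = trans (∑ℕ.sum-cong-≗ f≡0) (∑ℕ.sum-replicate-zero n)

sum-single : ∀ {n} i {f : Vector ℕ n} → (∀ {j} → j ≢ i → f j ≡ 0) → sum f ≡ f i
sum-single {ℕ.suc n} i {f} f≡0 = begin
  sum f                          ≡⟨ ∑ℕ.sum-remove f ⟩
  f i ℕ.+ sum (removeAt f i)     ≡⟨ cong (f i ℕ.+_) (sum-zero λ j → f≡0 (Fin.punchInᵢ≢i i j)) ⟩
  f i ℕ.+ 0                      ≡⟨ ℕ.+-identityʳ (f i) ⟩
  f i                            ∎
  where open ≡-Reasoning

sum-ones : ∀ n → sum (replicate n 1) ≡ n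
sum-ones ℕ.zero    = refl
sum-ones (ℕ.suc n) = cong ℕ.suc (sum-ones n)

kronecker : ∀ {n} → Fin n → Fin n → ℕ
kronecker i j = if does (i Fin.≟ j) then 1 else 0

kronecker-diagonal : ∀ {n} (i : Fin n) → kronecker i i ≡ 1
kronecker-diagonal i = cong (if_then 1 else 0) (dec-true (i Fin.≟ i) refl)

kronecker-≢ : ∀ {n} {i j : Fin n} → i ≢ j → kronecker i j ≡ 0
kronecker-≢ {i = i} {j} p = cong (if_then 1 else 0) (dec-false (i Fin.≟ j) p)

sum-kronecker : ∀ {n} (j : Fin n) → ∑[ i < n ] kronecker i j ≡ 1
sum-kronecker j = trans (sum-single j {λ i → kronecker i j} kronecker-≢) (kronecker-diagonal j)

-- Sign reversal of configurations and its compatibility with `D`.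

module SignReversal {V : ℕ} (T : Tree V) where

  open Tree T
  open Configurations T hiding (SH)

  oppositeᵐ : Maybe Sign → Maybe Sign
  oppositeᵐ = Maybe.map opposite

  reverse : Config → Config
  reverse C = record
    { mark  = oppositeᵐ ∘ mark C
    ; red   = red C
    ; valid = λ v → Sum.map
        (λ ((s , p) , no-red) → (opposite s , cong oppositeᵐ p) , no-red)
        (λ (p , matched) → cong oppositeᵐ p , matched)
        (valid C v)
    }

  reverse-cong : ∀ {C C′} → C ≈ C′ → reverse C ≈ reverse C′
  reverse-cong (mk≈ p q) = mk≈ (cong oppositeᵐ ∘ p) q

  reverse-involutive : ∀ C → reverse (reverse C) ≈ C
  reverse-involutive C = mk≈ (λ v → oppositeᵐ-involutive (mark C v)) (λ _ → refl)
    where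
    oppositeᵐ-involutive : ∀ m → oppositeᵐ (oppositeᵐ m) ≡ m
    oppositeᵐ-involutive (just s) = cong just (Sign.opposite-involutive s)
    oppositeᵐ-involutive nothing  = refl

  map-reverse-cong : ∀ {x y} → x SC.≈ y → map reverse x SC.≈ map reverse y
  map-reverse-cong = LinearExtension.map-≈ configs configs reverse-cong

  map-reverse-involutive : ∀ x → map reverse (map reverse x) SC.≈ x
  map-reverse-involutive []      = SC.≈-refl
  map-reverse-involutive (C ∷ x) = SC.∷-cong (reverse-involutive C) (map-reverse-involutive x)

  -- Both sides agree at the two ends of `e`, at all other vertices and on the edges, which is all
  -- that `resolve-unique` asks. The same `p` serves on both sides because reversal leaves `red`
  -- untouched.
  reverse-resolve : ∀ C e p s → reverse (resolve C e p s) ≈ resolve (reverse C) e p (opposite s)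
  reverse-resolve C e p s = resolve-unique (reverse C) e p (opposite s)
    (cong oppositeᵐ (mark-first C e p s))
    (cong oppositeᵐ (mark-second C e p s (ends-distinct e)))
    (λ v∉e → cong oppositeᵐ (mark-other C e p s v∉e))
    (red-self C e p s) (red-other C e p s)

  reverse-resolutions : ∀ C e → map reverse (resolutions C e) SC.≈ resolutions (reverse C) e
  reverse-resolutions C e with red C e Bool.≟ true
  ... | no _  = SC.≈-refl
  ... | yes p = SC.≈-trans
    (SC.∷-cong (reverse-resolve C e p Sign.+) (SC.∷-cong (reverse-resolve C e p Sign.-) SC.≈-refl))
    -- Reversal has exchanged the two resolutions of `e`; commutativity restores their order.
    (SC.++-comm (resolve (reverse C) e p Sign.- ∷ []) (resolve (reverse C) e p Sign.+ ∷ []))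

  map-sum : ∀ {n} (f : Vector (List Config) n) → map reverse (∑.sum f) ≡ ∑.sum (map reverse ∘ f)
  map-sum {ℕ.zero}  f = refl
  map-sum {ℕ.suc n} f = trans (map-++ reverse (f zero) _)
                              (cong (map reverse (f zero) ++_) (map-sum (f ∘ suc)))

  D-reverse : ∀ x → map reverse (D x) SC.≈ D (map reverse x)
  D-reverse []      = SC.≈-refl
  D-reverse (C ∷ x) = SC.≈-trans
    (SC.≈-reflexive (map-++ reverse (∑.sum (resolutions C)) _))
    (SC.++-cong
      (SC.≈-trans (SC.≈-reflexive (map-sum (resolutions C)))
        (∑.sum-cong-≋ (reverse-resolutions C)))
      (D-reverse x))

  -- Counting the vertices of a configuration.

  module _ (C : Config) where

    private
      a b : Fin E → Fin V
      a = proj₁ ∘ ends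
      b = proj₂ ∘ ends

    -- The incidence matrix of the tree, written as a sum over the two ends so that each column
    -- visibly sums to 2. Its entries are 0 or 1 because a tree has no loops.
    #endsAt : Fin V → Fin E → ℕ
    #endsAt v e = kronecker v (a e) ℕ.+ kronecker v (b e)

    #endsAt-∉ : ∀ {v e} → ¬ v endOf e → #endsAt v e ≡ 0
    #endsAt-∉ v∉e = cong₂ ℕ._+_ (kronecker-≢ (v∉e ∘ inj₁)) (kronecker-≢ (v∉e ∘ inj₂))

    #endsAt-∈ : ∀ {v e} → v endOf e → #endsAt v e ≡ 1
    #endsAt-∈ {e = e} (inj₁ refl) = cong₂ ℕ._+_ (kronecker-diagonal (a e)) (kronecker-≢ (ends-distinct e))
    #endsAt-∈ {e = e} (inj₂ refl) = cong₂ ℕ._+_ (kronecker-≢ (ends-distinct e ∘ sym)) (kronecker-diagonal (b e))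

    sum-#endsAt : ∀ e → ∑[ v < V ] #endsAt v e ≡ 2
    sum-#endsAt e = trans (∑ℕ.∑-distrib-+ (λ v → kronecker v (a e)) (λ v → kronecker v (b e)))
                          (cong₂ ℕ._+_ (sum-kronecker (a e)) (sum-kronecker (b e)))

    redAt : Fin V → Fin E → ℕ
    redAt v e = if red C e then #endsAt v e else 0

    redAt-0 : ∀ {v e} → ¬ (v endOf e × red C e ≡ true) → redAt v e ≡ 0
    redAt-0 {e = e} ¬p with red C e
    ... | true  = #endsAt-∉ λ v∈e → ¬p (v∈e , refl)
    ... | false = refl

    redAt-1 : ∀ {v e} → v endOf e → red C e ≡ true → redAt v e ≡ 1
    redAt-1 v∈e p rewrite p = #endsAt-∈ v∈e

    sum-redAt : ∀ e → ∑[ v < V ] redAt v e ≡ #red (red C e) ℕ.+ #red (red C e)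
    sum-redAt e with red C e
    ... | true  = sum-#endsAt e
    ... | false = ∑ℕ.sum-replicate-zero V

    -- The pluses of `C` are counted as the minuses of `reverse C`.
    #signs : Fin V → ℕ
    #signs v = #minus (mark (reverse C) v) ℕ.+ #minus (mark C v)

    -- A marked vertex has one sign and no red edge; an unmarked vertex has no sign and exactly one
    -- red edge.
    at-vertex : ∀ v → #signs v ℕ.+ ∑[ e < E ] redAt v e ≡ 1
    at-vertex v with valid C v
    ... | inj₁ ((s , p) , no-red) rewrite p =
          cong₂ ℕ._+_ (one-sign s) (sum-zero λ e → redAt-0 λ (v∈e , q) → no-red e v∈e q)
      where
      one-sign : ∀ s → #minus (just (opposite s)) ℕ.+ #minus (just s) ≡ 1
      one-sign Sign.+ = refl
      one-sign Sign.- = refl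
    ... | inj₂ (p , e , (v∈e , q) , unique) rewrite p =
          -- As `v` is unmarked, `#signs v` has reduced to 0; uniqueness of the red edge at `v`
          -- kills every term but that of `e`.
          trans (sum-single e {redAt v} λ f≢e → redAt-0 λ r → f≢e (sym (unique r)))
                (redAt-1 v∈e q)

    #redEdges : ℕ
    #redEdges = sum (#red ∘ red C)

    -- Double counting: `at-vertex` is summed over all vertices, and after exchanging the two sums
    -- each red edge contributes 2. One copy of `#redEdges` is absorbed into `E# C`.
    vertex-count : V ≡ Q (reverse C) ℕ.+ E# C ℕ.+ #redEdges
    vertex-count = begin
      V
        ≡⟨ sum-ones V ⟨
      ∑[ v < V ] 1
        ≡⟨ ∑ℕ.sum-cong-≗ at-vertex ⟨
      ∑[ v < V ] (#signs v ℕ.+ ∑[ e < E ] redAt v e)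
        ≡⟨ ∑ℕ.∑-distrib-+ #signs (λ v → ∑[ e < E ] redAt v e) ⟩
      ∑[ v < V ] #signs v ℕ.+ ∑[ v < V ] ∑[ e < E ] redAt v e
        ≡⟨ cong₂ ℕ._+_ (∑ℕ.∑-distrib-+ (#minus ∘ mark (reverse C)) (#minus ∘ mark C))
                       (∑ℕ.∑-comm redAt) ⟩
      (Q (reverse C) ℕ.+ Q C) ℕ.+ ∑[ e < E ] ∑[ v < V ] redAt v e
        ≡⟨ cong (Q (reverse C) ℕ.+ Q C ℕ.+_)
             (trans (∑ℕ.sum-cong-≗ sum-redAt) (∑ℕ.∑-distrib-+ (#red ∘ red C) (#red ∘ red C))) ⟩
      (Q (reverse C) ℕ.+ Q C) ℕ.+ (#redEdges ℕ.+ #redEdges)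
        ≡⟨ regroup (Q (reverse C)) (Q C) #redEdges ⟩
      Q (reverse C) ℕ.+ E# C ℕ.+ #redEdges
        ∎
      where
      open ≡-Reasoning
      regroup : ∀ p k r → (p ℕ.+ k) ℕ.+ (r ℕ.+ r) ≡ p ℕ.+ (k ℕ.+ r) ℕ.+ r
      regroup = solve-∀-ℕ

    Q-reverse : + Q (reverse C) ≡ + V - + 2 * + E# C + + Q C
    -- Addition of nonnegative integers computes to the image of the natural sum, so the bracket in
    -- `identity` is the right side of `vertex-count`.
    Q-reverse = trans (identity (+ Q (reverse C)) (+ Q C) (+ #redEdges))
      (cong (λ m → + m - + 2 * + E# C + + Q C) (sym vertex-count))
      where
      identity : ∀ p k r → p ≡ (p + (k + r) + r) - + 2 * (k + r) + k
      identity = solve-∀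

    E#-reverse : + E# (reverse C) ≡ + V - + E# C
    E#-reverse = trans (identity (+ Q (reverse C)) (+ E# C) (+ #redEdges))
      (cong (λ m → + m - + E# C) (sym vertex-count))
      where
      identity : ∀ p n r → p + r ≡ (p + n + r) - n
      identity = solve-∀

  -- Bidegrees, cocycles and coboundaries under reversal.

  SC-reverse : ∀ {k n x} → SC[ k , n ] x → SC[ + V - + 2 * n + k , + V - n ] (map reverse x)
  SC-reverse (y , py , y≈x) = map reverse y
    -- Matching on `refl` turns `k` and `n` into the actual counts of `C`.
    , All.map⁺ (All.map (λ { {C} (refl , refl) → Q-reverse C , E#-reverse C }) py)
    , map-reverse-cong y≈x

  cocycle-reverse : ∀ {k n x} → Cocycle k n x →
                    Cocycle (+ V - + 2 * n + k) (+ V - n) (map reverse x)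
  cocycle-reverse {x = x} (x∈SC , Dx≈0) = SC-reverse x∈SC
    , SC.≈-trans (SC.≈-sym (D-reverse x)) (map-reverse-cong Dx≈0)

  coboundary-reverse : ∀ {k n x} → Coboundary k n x →
                       Coboundary (+ V - + 2 * n + k) (+ V - n) (map reverse x)
  coboundary-reverse {k} {n} {x} (y , y∈SC , Dy≈x) = map reverse y
    -- The primitive `y` has degree `k - 1ℤ`; since `k` enters the new degree with coefficient 1,
    -- the reversed primitive is again one degree below.
    , subst (λ j → SC[ j , + V - n ] (map reverse y)) (predecessor (+ V) n k) (SC-reverse y∈SC)
    , SC.≈-trans (SC.≈-sym (D-reverse y)) (map-reverse-cong Dy≈x)
    where
    predecessor : ∀ v n k → v - + 2 * n + (k - 1ℤ) ≡ v - + 2 * n + k - 1ℤ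
    predecessor = solve-∀

  -- The change of bidegree is an involution, so reversing from the target bidegree leads back to
  -- the original one.
  reverse²-k : ∀ v n k → v - + 2 * (v - n) + (v - + 2 * n + k) ≡ k
  reverse²-k = solve-∀

  reverse²-n : ∀ v n → v - (v - n) ≡ n
  reverse²-n = solve-∀

  cocycle-reverse⁻ : ∀ k n {x} → Cocycle (+ V - + 2 * n + k) (+ V - n) x →
                     Cocycle k n (map reverse x)
  cocycle-reverse⁻ k n {x} p = subst₂ (λ k n → Cocycle k n (map reverse x))
    (reverse²-k (+ V) n k) (reverse²-n (+ V) n) (cocycle-reverse p)

  coboundary-reverse⁻ : ∀ k n {x} → Coboundary (+ V - + 2 * n + k) (+ V - n) x →
                        Coboundary k n (map reverse x)
  coboundary-reverse⁻ k n {x} p = subst₂ (λ k n → Coboundary k n (map reverse x))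
    (reverse²-k (+ V) n k) (reverse²-n (+ V) n) (coboundary-reverse p)

  -- The isomorphism on cohomology.

  module _ (k n : ℤ) where

    private
      k′ n′ : ℤ
      k′ = + V - + 2 * n + k
      n′ = + V - n

      module SH₁ = Module (SH T k n)
      module SH₂ = Module (SH T k′ n′)

      reflexive : ∀ {x y : SH₂.Carrierᴹ} → proj₁ x SC.≈ proj₁ y → x SH₂.≈ᴹ y
      reflexive = Subquotient.reflexive SC
        (cocycle-isSubmodule k′ n′) (coboundary-isSubmodule k′ n′)

    SH-reverse : SH₁.Carrierᴹ → SH₂.Carrierᴹ
    SH-reverse (x , x-cocycle) = map reverse x , cocycle-reverse x-cocycle

    SH-reverse-cong : ∀ {x y} → x SH₁.≈ᴹ y → SH-reverse x SH₂.≈ᴹ SH-reverse y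
    -- Negation is the identity over `𝔽₂`, so the difference of `x` and `y` is `x ++ y`.
    SH-reverse-cong {x , _} {y , _} (Subquotient.mk≈ p) = Subquotient.mk≈
      (subst (Coboundary k′ n′) (map-++ reverse x y) (coboundary-reverse p))

    -- Reversing the coboundary that relates the two images recovers, up to `SC.≈`, the difference
    -- of `x` and `y`.
    SH-reverse-injective : ∀ {x y} → SH-reverse x SH₂.≈ᴹ SH-reverse y → x SH₁.≈ᴹ y
    SH-reverse-injective {x , _} {y , _} (Subquotient.mk≈ p) = Subquotient.mk≈
      (IsSubmodule.resp (coboundary-isSubmodule k n)
        (SC.≈-trans (SC.≈-reflexive (map-++ reverse (map reverse x) _))
          (SC.++-cong (map-reverse-involutive x) (map-reverse-involutive y)))
        (coboundary-reverse⁻ k n p))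

    SH-reverse-isIsomorphism :
      IsModuleIsomorphism (rawModule (SH T k n)) (rawModule (SH T k′ n′)) SH-reverse
    SH-reverse-isIsomorphism = record
      { isModuleMonomorphism = record
        { isModuleHomomorphism = record
          { isBimoduleHomomorphism = record
            { +ᴹ-isGroupHomomorphism = record
              { isMonoidHomomorphism = record
                { isMagmaHomomorphism = record
                  { isRelHomomorphism = record { cong = SH-reverse-cong }
                  ; homo = λ (x , _) (y , _) → reflexive (SC.≈-reflexive (map-++ reverse x y))
                  }
                ; ε-homo = reflexive SC.≈-refl
                }
              ; ⁻¹-homo = λ _ → reflexive SC.≈-refl
              }
            ; *ₗ-homo = *-homo
            ; *ᵣ-homo = *-homo
            }
          }
        ; injective = SH-reverse-injective
        }
      -- The preimage of `y` is its own reversal, by involutivity.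
      ; surjective = λ (y , y-cocycle) → (map reverse y , cocycle-reverse⁻ k n y-cocycle)
          , λ z≈x → SH₂.≈ᴹ-trans (SH-reverse-cong z≈x) (reflexive (map-reverse-involutive y))
      }
      where
      *-homo : ∀ r x → SH-reverse (r SH₁.*ₗ x) SH₂.≈ᴹ (r SH₂.*ₗ SH-reverse x)
      *-homo false x = reflexive SC.≈-refl
      *-homo true  x = reflexive SC.≈-refl

open SignReversal using (SH-reverse; SH-reverse-isIsomorphism)

-- Naturality under isomorphisms of trees.

module _ {V : ℕ} {S T : Tree V} (g : S ≅ T) where

  private
    module S = SignReversal S
    module T = SignReversal T
  open Configurations T using (module SC; mk≈; cocycle-isSubmodule; coboundary-isSubmodule)
  open Induced g using (push)

  -- Reversal changes the values of the marks while `push` only reindexes vertices and edges, so on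
  -- each configuration the two commute by computation.
  reverse-push : ∀ x → map T.reverse (map push x) SC.≈ map push (map S.reverse x)
  reverse-push []      = SC.≈-refl
  reverse-push (C ∷ x) = SC.∷-cong (mk≈ (λ _ → refl) (λ _ → refl)) (reverse-push x)

  SH-reverse-natural : ∀ k n x → Module._≈ᴹ_ (SH T (+ V - + 2 * n + k) (+ V - n))
    (SH-reverse T k n (SH-map g k n x))
    (SH-map g (+ V - + 2 * n + k) (+ V - n) (SH-reverse S k n x))
  SH-reverse-natural k n (x , _) = Subquotient.reflexive (Configurations.SC T)
    (cocycle-isSubmodule k′ n′) (coboundary-isSubmodule k′ n′) (reverse-push x)
    where
    k′ n′ : ℤ
    k′ = + V - + 2 * n + k
    n′ = + V - n

lemma2 : (V : ℕ) →
    Σ[ φ ∈ ((T : Tree V) (k n : ℤ) → Carrierᴹ (SH T k n) → Carrierᴹ (SH T (+ V - + 2 * n + k) (+ V - n))) ]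
    ((T : Tree V) (k n : ℤ) →
    IsModuleIsomorphism (rawModule (SH T k n)) (rawModule (SH T (+ V - + 2 * n + k) (+ V - n))) (φ T k n))
    × ((S T : Tree V) (g : S ≅ T) (k n : ℤ) (x : Carrierᴹ (SH S k n)) →
    Module._≈ᴹ_ (SH T (+ V - + 2 * n + k) (+ V - n))
    (φ T k n (SH-map g k n x))
    (SH-map g (+ V - + 2 * n + k) (+ V - n) (φ S k n x)))
lemma2 V = SH-reverse , SH-reverse-isIsomorphism , λ S T → SH-reverse-natural
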